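{- Let $G$ be a graph of order $n$ and minimum degree $\delta$. Then $$\eta(G)\ge \frac{n}{(n-\delta)^2}+\frac12-\frac{1}{2(n-\delta)}.$$ Moreover, the bound is sharp: for every pair of integers $a\ge 1$ and $b\ge 1$, there exists a graph $G$, of order $n$ and minimum degree $\delta$, with $\eta(G)=a$ and $n-\delta=b$, for which equality holds in the displayed inequality.
   Context: All graphs are finite and simple (with at least one vertex). $\mathbb N$ denotes the positive integers and $[k]=\{1,2,\ldots,k\}$. For a graph $G$ and a labeling $\ell:V(G)\to\mathbb N$, put $S_\ell(v)=\sum_{w\in N(v)}\ell(w)$, where $N(v)$ is the open neighborhood of $v$. The labeling $\ell$ is an additive labeling if $S_\ell(u)\ne S_\ell(v)$ for every edge $uv\in E(G)$. The additive number $\eta(G)$ is the least positive integer $k$ such that $G$ has an additive labeling $\ell:V(G)\to[k]$. -}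

module Defs where

open import Level using (0ℓ)
open import Data.Bool using (Bool; true; false)
open import Data.Nat
  using (ℕ; zero; suc; _+_; _*_; _∸_; _^_; _≤_; _<_; z≤n; s≤s; NonZero; >-nonZero)
open import Data.Nat.Properties
  using ( _≟_; _≤?_; ≤-refl; ≤-<-trans; <⇒≤; m<n⇒0<n∸m; m*n≢0; m^n≢0; m^n>0
        ; ^-monoʳ-≤; *-distribˡ-+; *-zeroʳ; *-identityˡ; *-assoc; *-cancelˡ-≡
        ; suc-injective; even≢odd )
import Data.Integer as ℤ
open import Data.Rational using (ℚ; ½; _/_) renaming (_+_ to _+ℚ_; _-_ to _-ℚ_)
open import Data.Fin using (Fin; zero; suc; toℕ; fromℕ<)
open import Data.Fin.Properties using (any?; all?; toℕ<n; toℕ-fromℕ<)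
open import Data.List using (List; allFin; filter; length; map; sum; tabulate)
open import Data.List.Properties using (map-cong; filter-notAll; length-tabulate)
open import Data.List.Extrema.Nat using (min; min≤v⁺)
import Data.List.Relation.Unary.Any as Any
open import Data.List.Relation.Unary.Any.Properties using (map⁺)
open import Data.List.Membership.Propositional.Properties using (∈-allFin)
open import Data.Product using (Σ; ∃; _×_; _,_; proj₁; proj₂)
open import Data.Sum using (inj₁; inj₂)
open import Data.Empty using (⊥-elim)
import Data.Vec.Functional as Vector
open import Function using (_∘_; id)
open import Relation.Binary using (Rel; Decidable; Symmetric; Irreflexive)
open import Relation.Binary.PropositionalEquality
  using (_≡_; _≢_; _≗_; refl; sym; trans; cong; cong₂; subst)
open import Relation.Nullary using (Dec; yes; no; does; ¬?)
open import Relation.Nullary.Decidable using (map′; _×-dec_; _→-dec_; dec-true; dec-false)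
import Relation.Unary as U

record Graph : Set₁ where
  infix 4 _~_ _~?_
  field
    order     : ℕ
    nonEmpty  : NonZero order

  Vertex : Set
  Vertex = Fin order

  field
    _~_       : Rel Vertex 0ℓ
    _~?_      : Decidable _~_
    ~-sym     : Symmetric _~_
    ~-irrefl  : Irreflexive _≡_ _~_

open Graph public using (order; Vertex)

module _ (G : Graph) where
  open Graph G using (_~_; _~?_; ~-irrefl; nonEmpty)

  N : Vertex G → List (Vertex G)
  N v = filter (v ~?_) (allFin (order G))

  degree : Vertex G → ℕ
  degree v = length (N v)

  -- The seed  order G  exceeds every degree, and there is at least one vertex,
  -- so it never is the minimum.
  δ : ℕ
  δ = min (order G) (map degree (allFin (order G)))

  degree<order : ∀ v → degree v < order G
  degree<order v =
    subst (degree v <_) (length-tabulate {n = order G} id)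
      (filter-notAll (v ~?_) (allFin (order G))
        (Any.map (λ v≡w → ~-irrefl v≡w) (∈-allFin v)))

  δ≤degree : ∀ v → δ ≤ degree v
  δ≤degree v =
    min≤v⁺ (order G) _
      (inj₂ (map⁺ (Any.map (λ { refl → ≤-refl }) (∈-allFin v))))

  private
    vertex : ∀ n → NonZero n → Fin n
    vertex (suc n) _ = zero

  δ<order : δ < order G
  δ<order = ≤-<-trans (δ≤degree v) (degree<order v)
    where v = vertex (order G) nonEmpty

  order∸δ≢0 : NonZero (order G ∸ δ)
  order∸δ≢0 = >-nonZero (m<n⇒0<n∸m δ<order)

  S : (Vertex G → ℕ) → Vertex G → ℕ
  S ℓ v = sum (map ℓ (N v))

  IsAdditive : (Vertex G → ℕ) → Set
  IsAdditive ℓ = ∀ u v → u ~ v → S ℓ u ≢ S ℓ v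

  HasAdditiveLabeling : ℕ → Set
  HasAdditiveLabeling k =
    Σ (Vertex G → ℕ) λ ℓ → (∀ v → 1 ≤ ℓ v × ℓ v ≤ k) × IsAdditive ℓ

  IsAdditiveNumber : ℕ → Set
  IsAdditiveNumber k =
    1 ≤ k × HasAdditiveLabeling k ×
    (∀ j → 1 ≤ j → HasAdditiveLabeling j → k ≤ j)

private
  labeling? : ∀ k n {P : (Fin n → ℕ) → Set} →
    (∀ {f g} → f ≗ g → P f → P g) → U.Decidable P →
    Dec (Σ (Fin n → ℕ) λ f → (∀ v → 1 ≤ f v × f v ≤ k) × P f)
  labeling? k zero resp P? =
    map′ (λ p → Vector.[] , (λ ()) , p)
         (λ { (f , _ , p) → resp (λ ()) p })
         (P? Vector.[])
  labeling? k (suc n) {P} resp P? =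
    map′ to from
      (any? λ i → labeling? k n
        {P = λ f → P (suc (toℕ i) Vector.∷ f)}
        (λ f≗g → resp λ { zero → refl ; (suc j) → f≗g j })
        (λ f → P? (suc (toℕ i) Vector.∷ f)))
    where
    to : (∃ λ (i : Fin k) → Σ (Fin n → ℕ) λ f →
           (∀ v → 1 ≤ f v × f v ≤ k) × P (suc (toℕ i) Vector.∷ f)) →
         Σ (Fin (suc n) → ℕ) λ f → (∀ v → 1 ≤ f v × f v ≤ k) × P f
    to (i , f , b , p) =
      suc (toℕ i) Vector.∷ f , (λ { zero → s≤s z≤n , toℕ<n i ; (suc j) → b j }) , p

    from : (Σ (Fin (suc n) → ℕ) λ f → (∀ v → 1 ≤ f v × f v ≤ k) × P f) →
           ∃ λ (i : Fin k) → Σ (Fin n → ℕ) λ f →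
             (∀ v → 1 ≤ f v × f v ≤ k) × P (suc (toℕ i) Vector.∷ f)
    from (f , b , p) = head (f zero) refl (b zero)
      where
      head : ∀ c → f zero ≡ c → 1 ≤ c × c ≤ k →
             ∃ λ (i : Fin k) → Σ (Fin n → ℕ) λ f →
               (∀ v → 1 ≤ f v × f v ≤ k) × P (suc (toℕ i) Vector.∷ f)
      head (suc c) eq (_ , c<k) =
        fromℕ< c<k , f ∘ suc , b ∘ suc ,
        resp (λ { zero → trans eq (cong suc (sym (toℕ-fromℕ< c<k)))
                ; (suc j) → refl }) p

  least : {P : ℕ → Set} → U.Decidable P → ∀ m → P m →
          ∃ λ k → P k × (∀ j → P j → k ≤ j)
  least P? m pm with P? zero
  ... | yes p0 = zero , p0 , λ _ _ → z≤n
  least P? zero pm | no ¬p0 = ⊥-elim (¬p0 pm)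
  least {P} P? (suc m) pm | no ¬p0 with least (P? ∘ suc) m pm
  ... | k , pk , k≤ = suc k , pk ,
        λ { zero p0 → ⊥-elim (¬p0 p0) ; (suc j) pj → s≤s (k≤ j pj) }

  bit : Bool → ℕ
  bit false = 0
  bit true  = 1

  binary : ∀ n → (Fin n → Bool) → ℕ
  binary zero    p = 0
  binary (suc n) p = bit (p zero) + 2 * binary n (p ∘ suc)

  binary-injective : ∀ n p q → binary n p ≡ binary n q → p ≗ q
  binary-injective (suc n) p q eq = λ { zero → proj₁ r ; (suc i) → proj₂ r i }
    where
    split : ∀ a b x y → bit a + 2 * x ≡ bit b + 2 * y → a ≡ b × x ≡ y
    split false false x y e = refl , *-cancelˡ-≡ x y 2 e
    split false true  x y e = ⊥-elim (even≢odd x y e)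
    split true  false x y e = ⊥-elim (even≢odd y x (sym e))
    split true  true  x y e = refl , *-cancelˡ-≡ x y 2 (suc-injective e)

    r : p zero ≡ q zero × p ∘ suc ≗ q ∘ suc
    r with split (p zero) (q zero) _ _ eq
    ... | e , es = e , binary-injective n _ _ es

  sum-filter-binary : ∀ {A : Set} {P : A → Set} (P? : U.Decidable P) (ℓ : A → ℕ) c n
    (g : Fin n → A) → (∀ i → ℓ (g i) ≡ c * 2 ^ toℕ i) →
    sum (map ℓ (filter P? (tabulate g))) ≡ c * binary n (λ i → does (P? (g i)))
  sum-filter-binary P? ℓ c zero g h = sym (*-zeroʳ c)
  sum-filter-binary P? ℓ c (suc n) g h
    with does (P? (g zero))
       | sum-filter-binary P? ℓ (c * 2) n (g ∘ suc)
           (λ i → trans (h (suc i)) (sym (*-assoc c 2 _)))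
  ... | false | ih = trans ih (*-assoc c 2 _)
  ... | true  | ih = trans (cong₂ _+_ (h zero) (trans ih (*-assoc c 2 _)))
                           (sym (*-distribˡ-+ c 1 _))

module _ (G : Graph) where
  open Graph G using (_~_; _~?_; ~-irrefl)

  private
    n = order G

    isAdditive-resp : ∀ {f g} → f ≗ g → IsAdditive G f → IsAdditive G g
    isAdditive-resp f≗g add u v u~v eq = add u v u~v
      (trans (cong sum (map-cong f≗g (N G u)))
        (trans eq (sym (cong sum (map-cong f≗g (N G v))))))

    hasAdditiveLabeling? : U.Decidable (HasAdditiveLabeling G)
    hasAdditiveLabeling? k = labeling? k n {P = IsAdditive G} isAdditive-resp
      (λ ℓ → all? λ u → all? λ v → (u ~? v) →-dec ¬? (S G ℓ u ≟ S G ℓ v))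

    -- Label vertex i by 2^i: the neighbourhood sums are binary encodings of
    -- the neighbourhoods, and adjacent vertices have distinct neighbourhoods.
    powers : HasAdditiveLabeling G (2 ^ n)
    powers = ℓ , (λ v → m^n>0 2 (toℕ v) , ^-monoʳ-≤ 2 (<⇒≤ (toℕ<n v))) , additive
      where
      ℓ : Vertex G → ℕ
      ℓ v = 2 ^ toℕ v

      S≡ : ∀ v → S G ℓ v ≡ binary n (λ w → does (v ~? w))
      S≡ v = trans
        (sum-filter-binary (v ~?_) ℓ 1 n id (λ i → sym (*-identityˡ _)))
        (*-identityˡ _)

      additive : IsAdditive G ℓ
      additive u v u~v eq with
        trans (sym (dec-true (u ~? v) u~v))
          (trans (binary-injective n _ _ (trans (sym (S≡ u)) (trans eq (S≡ v))) v)
                 (dec-false (v ~? v) (~-irrefl refl)))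
      ... | ()

  abstract
    additiveNumber : ∃ (IsAdditiveNumber G)
    additiveNumber with least (λ k → (1 ≤? k) ×-dec hasAdditiveLabeling? k)
                              (2 ^ n) (m^n>0 2 n , powers)
    ... | k , (1≤k , has) , k≤ = k , 1≤k , has , λ j 1≤j h → k≤ j (1≤j , h)

  η : ℕ
  η = proj₁ additiveNumber

  η-isAdditiveNumber : IsAdditiveNumber G η
  η-isAdditiveNumber = proj₂ additiveNumber

  lowerBound : ℚ
  lowerBound = (ℤ.+ order G / c ^ 2) +ℚ ½ -ℚ (ℤ.+ 1 / (2 * c))
    where
    c = order G ∸ δ G
    instance
      c≢0 : NonZero c
      c≢0 = order∸δ≢0 G
      c²≢0 : NonZero (c ^ 2)
      c²≢0 = m^n≢0 c 2
      2c≢0 : NonZero (2 * c)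
      2c≢0 = m*n≢0 2 c

{-# OPTIONS --safe #-}
-- Write b = n − δ, let M(v) = V ∖ N(v), so that v ∈ M(v) and |M(v)| ≤ b, and let R(v) be the
-- sum of an additive labelling ℓ : V → [k] over M(v).  Since S(v) + R(v) is constant, R also
-- separates adjacent vertices.  Hence each class {R = r} lies in M(v) for any v in it, so it
-- has at most min(r, b) elements (all labels are ≥ 1), and r ≤ k b.  Summing over r = 0, …, k b
-- gives n ≤ k b² − b(b − 1)/2.
-- The bound is attained by the complete multipartite graph with parts of sizes min(r, b) for
-- r = 1, …, a b, where the labels of the r-th part are chosen in [a] with sum r.
module Submission where

open import Defs
open import Data.Nat using (ℕ; _∸_; _≤_)
open import Data.Integer using (+_)
open import Data.Rational using (_/_) renaming (_≤_ to _≤ℚ_)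
open import Data.Product using (Σ; _×_)
open import Relation.Binary.PropositionalEquality using (_≡_)

open import Data.Fin using (Fin)
import Data.Integer as ℤ
import Data.Integer.Properties as ℤ
open import Data.List
  using (List; []; _∷_; _++_; map; filter; length; lookup; allFin; downFrom; concatMap)
open import Data.List.Extrema.Nat using (v≤min⁺)
open import Data.List.Membership.Propositional.Properties using (∈-lookup)
open import Data.List.Properties
  using ( filter-all; filter-none; filter-≐; filter-++; length-++; length-map; length-tabulate
        ; map-∘; map-id; map-tabulate; tabulate-lookup; ++-identityʳ )
open import Data.List.Relation.Unary.All as All using (All; []; _∷_)
import Data.List.Relation.Unary.All.Properties as All
import Data.List.Relation.Unary.Any as Any
open import Data.Nat
  using (suc; zero; _+_; _*_; _^_; _<_; _⊓_; z≤n; s≤s; NonZero; pred; >-nonZero)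
open import Data.Nat.ListAction using (sum)
open import Data.Nat.Properties
open import Data.Nat.Tactic.RingSolver using (solve-∀)
open import Data.Product using (_,_; proj₁; proj₂)
open import Data.Rational using (½; fromℚᵘ) renaming (_+_ to _+ℚ_; _-_ to _-ℚ_; -_ to -ℚ_)
import Data.Rational.Properties as ℚ
open import Data.Rational.Unnormalised using (mkℚᵘ; *≡*; *≤*)
  renaming (_+_ to _+ᵘ_; _≤_ to _≤ᵘ_; _≃_ to _≃ᵘ_; ½ to ½ᵘ)
import Data.Rational.Unnormalised.Properties as ℚᵘ
open import Data.Sum using (_⊎_; inj₁; inj₂)
open import Level using (0ℓ)
open import Function using (_∘_; id)
open import Relation.Binary.PropositionalEquality
  using (_≢_; refl; sym; trans; cong; cong₂; subst; module ≡-Reasoning)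
open import Relation.Nullary using (¬?; yes; no; contradiction)
open import Relation.Nullary.Decidable using (decidable-stable)
open import Relation.Unary using (Pred; Decidable)

-- Counting and summing over filtered lists.

module _ {A : Set} where

  sum-filter-∁ : {P : Pred A 0ℓ} (P? : Decidable P) (f : A → ℕ) (xs : List A) →
    sum (map f (filter P? xs)) + sum (map f (filter (¬? ∘ P?) xs)) ≡ sum (map f xs)
  sum-filter-∁ P? f [] = refl
  sum-filter-∁ P? f (x ∷ xs) with ih ← sum-filter-∁ P? f xs | P? x
  ... | yes _ = trans (+-assoc (f x) _ _) (cong (_+_ (f x)) ih)
  ... | no  _ = trans (swap (sum (map f (filter P? xs))) (f x) _) (cong (_+_ (f x)) ih)
    where
    swap : ∀ m n o → m + (n + o) ≡ n + (m + o)
    swap = solve-∀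

  length-filter-∁ : {P : Pred A 0ℓ} (P? : Decidable P) (xs : List A) →
    length (filter P? xs) + length (filter (¬? ∘ P?) xs) ≡ length xs
  length-filter-∁ P? [] = refl
  length-filter-∁ P? (x ∷ xs) with ih ← length-filter-∁ P? xs | P? x
  ... | yes _ = cong suc ih
  ... | no  _ = trans (+-suc _ _) (cong suc ih)

  length-filter-∪ : {P Q R : Pred A 0ℓ}
    (P? : Decidable P) (Q? : Decidable Q) (R? : Decidable R) →
    (∀ {x} → P x → Q x ⊎ R x) → ∀ xs →
    length (filter P? xs) ≤ length (filter Q? xs) + length (filter R? xs)
  length-filter-∪ P? Q? R? P⊆Q∪R [] = z≤n
  length-filter-∪ P? Q? R? P⊆Q∪R (x ∷ xs)
    with ih ← length-filter-∪ P? Q? R? P⊆Q∪R xs | P? x | Q? x | R? x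
  ... | yes _ | yes _ | yes _ = s≤s (≤-trans ih (+-monoʳ-≤ _ (n≤1+n _)))
  ... | yes _ | yes _ | no  _ = s≤s ih
  ... | yes _ | no  _ | yes _ = ≤-trans (s≤s ih) (≤-reflexive (sym (+-suc _ _)))
  ... | no  _ | yes _ | yes _ = m≤n⇒m≤1+n (≤-trans ih (+-monoʳ-≤ _ (n≤1+n _)))
  ... | no  _ | yes _ | no  _ = m≤n⇒m≤1+n ih
  ... | no  _ | no  _ | yes _ = ≤-trans ih (+-monoʳ-≤ _ (n≤1+n _))
  ... | no  _ | no  _ | no  _ = ih
  ... | yes p | no ¬q | no ¬r with P⊆Q∪R p
  ...   | inj₁ q = contradiction q ¬q
  ...   | inj₂ r = contradiction r ¬r

  length-filter-mono : {P Q : Pred A 0ℓ} (P? : Decidable P) (Q? : Decidable Q) →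
    (∀ {x} → P x → Q x) → ∀ xs → length (filter P? xs) ≤ length (filter Q? xs)
  length-filter-mono P? Q? P⊆Q [] = z≤n
  length-filter-mono P? Q? P⊆Q (x ∷ xs) with ih ← length-filter-mono P? Q? P⊆Q xs | P? x | Q? x
  ... | yes _ | yes _ = s≤s ih
  ... | yes p | no ¬q = contradiction (P⊆Q p) ¬q
  ... | no  _ | yes _ = m≤n⇒m≤1+n ih
  ... | no  _ | no  _ = ih

  -- Union bound over the fibres of `f`: an element with `f x < m` lies in the fibre of some
  -- `r < m`, and `g r` bounds that fibre.
  length-filter-< : (f : A → ℕ) (g : ℕ → ℕ) (xs : List A) →
    (∀ r → length (filter (λ x → f x ≟ r) xs) ≤ g r) →
    ∀ m → length (filter (λ x → f x <? m) xs) ≤ sum (map g (downFrom m))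
  length-filter-< f g xs h zero =
    ≤-reflexive (cong length (filter-none (λ x → f x <? 0) (All.universal (λ _ ()) xs)))
  length-filter-< f g xs h (suc m) = ≤-trans
    (length-filter-∪ (λ x → f x <? suc m) (λ x → f x ≟ m) (λ x → f x <? m) cases xs)
    (+-mono-≤ (h m) (length-filter-< f g xs h m))
    where
    cases : ∀ {x} → f x < suc m → f x ≡ m ⊎ f x < m
    cases (s≤s fx≤m) with m≤n⇒m<n∨m≡n fx≤m
    ... | inj₁ lt = inj₂ lt
    ... | inj₂ eq = inj₁ eq

  length≤sum : (f : A → ℕ) → (∀ x → 1 ≤ f x) → ∀ xs → length xs ≤ sum (map f xs)
  length≤sum f 1≤f []       = z≤n
  length≤sum f 1≤f (x ∷ xs) = +-mono-≤ (1≤f x) (length≤sum f 1≤f xs)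

  sum≤*length : (f : A → ℕ) (k : ℕ) → (∀ x → f x ≤ k) → ∀ xs → sum (map f xs) ≤ k * length xs
  sum≤*length f k f≤k []       = z≤n
  sum≤*length f k f≤k (x ∷ xs) = ≤-trans
    (+-mono-≤ (f≤k x) (sum≤*length f k f≤k xs)) (≤-reflexive (sym (*-suc k _)))

  filter-map : {B : Set} {P : Pred B 0ℓ} (P? : Decidable P) (f : A → B) (xs : List A) →
    map f (filter (P? ∘ f) xs) ≡ filter P? (map f xs)
  filter-map P? f [] = refl
  filter-map P? f (x ∷ xs) with ih ← filter-map P? f xs | P? (f x)
  ... | yes _ = cong (f x ∷_) ih
  ... | no  _ = ih

  map-lookup-allFin : (xs : List A) → map (lookup xs) (allFin (length xs)) ≡ xs
  map-lookup-allFin xs = trans (map-tabulate id (lookup xs)) (tabulate-lookup xs)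

-- The sum of min(r, b) in closed form.

sum-⊓-≤ : ∀ b j → j ≤ b → 2 * sum (map (_⊓ b) (downFrom (suc j))) ≡ j * suc j
sum-⊓-≤ b zero    _   = refl
sum-⊓-≤ b (suc j) j<b
  rewrite m≤n⇒m⊓n≡m j<b
        | *-distribˡ-+ 2 (suc j) (sum (map (_⊓ b) (downFrom (suc j))))
        | sum-⊓-≤ b j (<⇒≤ j<b) = identity j
  where
  identity : ∀ j → 2 * suc j + j * suc j ≡ suc j * suc (suc j)
  identity = solve-∀

-- Up to `b` the terms form a triangular number; each of the `e` further terms is `b`.
sum-⊓-≥ : ∀ b e → 2 * sum (map (_⊓ b) (downFrom (suc (e + b)))) ≡ b * suc b + 2 * (e * b)
sum-⊓-≥ b zero    = trans (sum-⊓-≤ b b ≤-refl) (sym (+-identityʳ _))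
sum-⊓-≥ b (suc e)
  rewrite m≥n⇒m⊓n≡n (m≤n+m b (suc e))
        | *-distribˡ-+ 2 b (sum (map (_⊓ b) (downFrom (suc (e + b)))))
        | sum-⊓-≥ b e = identity b e
  where
  identity : ∀ b e → 2 * b + (b * suc b + 2 * (e * b)) ≡ b * suc b + 2 * (suc e * b)
  identity = solve-∀

-- A nonzero `k` puts the last index `k * b` at or beyond `b`, so `sum-⊓-≥` applies with excess
-- `(k - 1) * b`. The square is added on the left to avoid subtraction.
sum-⊓ : ∀ b k .{{_ : NonZero k}} →
  2 * sum (map (_⊓ b) (downFrom (suc (k * b)))) + b * b ≡ 2 * k * (b * b) + b
sum-⊓ b (suc k)
  rewrite +-comm b (k * b) | sum-⊓-≥ b (k * b) = identity b k
  where
  identity : ∀ b k → b * suc b + 2 * (k * b * b) + b * b ≡ 2 * suc k * (b * b) + b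
  identity = solve-∀

-- Non-neighbourhoods and the inequality over the naturals.

module _ (G : Graph) where
  open Graph G using (_~?_)

  nonN : Vertex G → List (Vertex G)
  nonN v = filter (¬? ∘ (v ~?_)) (allFin (order G))

  nonDegree : Vertex G → ℕ
  nonDegree v = length (nonN v)

  degree+nonDegree : ∀ v → degree G v + nonDegree v ≡ order G
  degree+nonDegree v =
    trans (length-filter-∁ (v ~?_) (allFin (order G))) (length-tabulate id)

  nonDegree≤ : ∀ v → nonDegree v ≤ order G ∸ δ G
  nonDegree≤ v = begin
    nonDegree v                                ≡⟨ m+n∸m≡n (degree G v) _ ⟨
    degree G v + nonDegree v ∸ degree G v      ≡⟨ cong (_∸ degree G v) (degree+nonDegree v) ⟩
    order G ∸ degree G v                       ≤⟨ ∸-monoʳ-≤ (order G) (δ≤degree G v) ⟩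
    order G ∸ δ G                              ∎
    where open ≤-Reasoning

  -- Recovers `δ` from non-degrees: the vertex attaining `b` bounds `order G ∸ δ G` below, and the
  -- uniform bound forces every degree, hence the minimum, to be at least `order G ∸ b`.
  order∸δ≡ : ∀ {b} → (∀ v → nonDegree v ≤ b) → ∀ v → nonDegree v ≡ b → order G ∸ δ G ≡ b
  order∸δ≡ {b} ≤b v refl = ≤-antisym (m≤n+o⇒m∸n≤o (order G) (δ G) n≤δ+b) (nonDegree≤ v)
    where
    n∸b≤deg : ∀ u → order G ∸ b ≤ degree G u
    n∸b≤deg u = m≤n+o⇒m∸n≤o (order G) b (subst (_≤ b + degree G u)
      (trans (+-comm (nonDegree u) _) (degree+nonDegree u)) (+-monoˡ-≤ (degree G u) (≤b u)))

    n≤δ+b : order G ≤ δ G + b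
    n≤δ+b = m∸n≤o⇒m≤o+n (order G) (δ G) b
      -- The minimum in `δ` also ranges over its seed `order G`, which the first argument handles;
      -- the second handles the degrees.
      (v≤min⁺ (m∸n≤m (order G) b) (All.map⁺ (All.universal n∸b≤deg (allFin (order G)))))
      where
      m∸n≤o⇒m≤o+n : ∀ m o n → m ∸ n ≤ o → m ≤ o + n
      m∸n≤o⇒m≤o+n m o n le = ≤-trans (m≤n+m∸n m n)
        (≤-trans (+-monoʳ-≤ n le) (≤-reflexive (+-comm n o)))

  module _ (ℓ : Vertex G → ℕ) where

    R : Vertex G → ℕ
    R v = sum (map ℓ (nonN v))

    S+R : ∀ v → S G ℓ v + R v ≡ sum (map ℓ (allFin (order G)))
    S+R v = sum-filter-∁ (v ~?_) ℓ (allFin (order G))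

    R≡⇒S≡ : ∀ {u v} → R u ≡ R v → S G ℓ u ≡ S G ℓ v
    R≡⇒S≡ {u} {v} eq = +-cancelʳ-≡ (R v) _ _
      (trans (cong (_+_ _) (sym eq)) (trans (S+R u) (sym (S+R v))))

    -- The lower bound uses `R≡⇒S≡`; this converse shows that the extremal labelling is additive.
    S≡⇒R≡ : ∀ {u v} → S G ℓ u ≡ S G ℓ v → R u ≡ R v
    S≡⇒R≡ {u} {v} eq = +-cancelˡ-≡ (S G ℓ v) _ _
      (trans (cong (_+ R u) (sym eq)) (trans (S+R u) (sym (S+R v))))

  order≤sum-⊓ : ∀ {k} → HasAdditiveLabeling G k →
    order G ≤ sum (map (_⊓ (order G ∸ δ G)) (downFrom (suc (k * (order G ∸ δ G)))))
  order≤sum-⊓ {k} (ℓ , bounds , additive) = begin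
    order G
      ≡⟨ length-tabulate id ⟨
    length V
      ≡⟨ cong length (filter-all (λ v → R ℓ v <? suc (k * b)) (All.universal R< V)) ⟨
    length (filter (λ v → R ℓ v <? suc (k * b)) V)
      ≤⟨ length-filter-< (R ℓ) (_⊓ b) V class≤ (suc (k * b)) ⟩
    sum (map (_⊓ b) (downFrom (suc (k * b))))
      ∎
    where
    open ≤-Reasoning
    b = order G ∸ δ G
    V = allFin (order G)

    R< : ∀ v → R ℓ v < suc (k * b)
    R< v = s≤s (≤-trans (sum≤*length ℓ k (proj₂ ∘ bounds) (nonN v)) (*-monoʳ-≤ k (nonDegree≤ v)))

    class⊆nonN : ∀ v → length (filter (λ w → R ℓ w ≟ R ℓ v) V) ≤ nonDegree v
    class⊆nonN v = length-filter-mono (λ w → R ℓ w ≟ R ℓ v) (¬? ∘ (v ~?_))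
      -- A neighbour of `v` in its own class would share its value of `R`, hence of `S`.
      (λ {w} eq v~w → additive v w v~w (R≡⇒S≡ ℓ (sym eq))) V

    class≤ : ∀ r → length (filter (λ w → R ℓ w ≟ r) V) ≤ r ⊓ b
    -- An empty class needs no argument. Otherwise a member `v` turns `r` into `R ℓ v`, and both
    -- bounds come from the non-neighbourhood of `v`.
    class≤ r with Any.any? (λ w → R ℓ w ≟ r) V
    ... | no ∄w = ≤-trans (≤-reflexive (cong length
            (filter-none (λ w → R ℓ w ≟ r) (All.¬Any⇒All¬ V ∄w)))) z≤n
    ... | yes ∃w with Any.satisfied ∃w
    ...   | v , refl = ⊓-glb
            (≤-trans (class⊆nonN v) (length≤sum ℓ (proj₁ ∘ bounds) (nonN v)))
            (≤-trans (class⊆nonN v) (nonDegree≤ v))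

  -- The inequality n ≤ k b² − b(b − 1)/2, cleared of subtraction and division.
  order-bound : let b = order G ∸ δ G in
    2 * order G + b * b ≤ 2 * η G * (b * b) + b
  order-bound with η-isAdditiveNumber G
  ... | 1≤η , has , _ = ≤-trans
    (+-monoˡ-≤ _ (*-monoʳ-≤ 2 (order≤sum-⊓ has)))
    (≤-reflexive (sum-⊓ (order G ∸ δ G) (η G) {{>-nonZero 1≤η}}))

-- From the natural-number inequality to the rational one.

-- Sums of fractions are moved to unnormalised rationals, where comparison is plain cross
-- multiplication without reduction to lowest terms.
fromℚᵘ-homo-+ : ∀ p q → fromℚᵘ p +ℚ fromℚᵘ q ≡ fromℚᵘ (p +ᵘ q)
fromℚᵘ-homo-+ p q = ℚ.toℚᵘ-injective (ℚᵘ.≃-trans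
  (ℚ.toℚᵘ-homo-+ (fromℚᵘ p) (fromℚᵘ q))
  (ℚᵘ.≃-trans (ℚᵘ.+-cong (ℚ.toℚᵘ-fromℚᵘ p) (ℚ.toℚᵘ-fromℚᵘ q))
              (ℚᵘ.≃-sym (ℚ.toℚᵘ-fromℚᵘ (p +ᵘ q)))))

fromℚᵘ-mono-≤ : ∀ {p q} → p ≤ᵘ q → fromℚᵘ p ≤ℚ fromℚᵘ q
fromℚᵘ-mono-≤ {p} {q} p≤q = ℚ.toℚᵘ-cancel-≤
  (ℚᵘ.≤-respˡ-≃ (ℚᵘ.≃-sym (ℚ.toℚᵘ-fromℚᵘ p))
    (ℚᵘ.≤-respʳ-≃ (ℚᵘ.≃-sym (ℚ.toℚᵘ-fromℚᵘ q)) p≤q))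

p+q-q≡p : ∀ p q → (p +ℚ q) -ℚ q ≡ p
p+q-q≡p p q = trans (ℚ.+-assoc p q (-ℚ q))
  (trans (cong (p +ℚ_) (ℚ.+-inverseʳ q)) (ℚ.+-identityʳ p))

module _ (n k c : ℕ) where

  private
    -- This and `rhs-identity` evaluate the two cross products of n/c² + 1/2 against k + 1/(2c),
    -- with `suc c` for c, and extract the common factor 2c.
    lhs-identity : (n * 2 + 1 * (suc c ^ 2)) * (1 * (2 * suc c))
                 ≡ (2 * n + suc c * suc c) * (2 * suc c)
    lhs-identity = identity n (suc c)
      where
      identity : ∀ n c → (n * 2 + 1 * (c * (c * 1))) * (1 * (2 * c)) ≡ (2 * n + c * c) * (2 * c)
      identity = solve-∀

    rhs-identity : (k * (2 * suc c) + 1 * 1) * (suc c ^ 2 * 2)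
                 ≡ (2 * k * (suc c * suc c) + suc c) * (2 * suc c)
    rhs-identity = identity k (suc c)
      where
      identity : ∀ k c → (k * (2 * c) + 1 * 1) * (c * (c * 1) * 2)
               ≡ (2 * k * (c * c) + c) * (2 * c)
      identity = solve-∀

    cast : ∀ x y d e → (+ x ℤ.* + d ℤ.+ + y ℤ.* + e) ≡ + (x * d + y * e)
    cast x y d e = sym (trans (ℤ.pos-+ (x * d) (y * e)) (cong₂ ℤ._+_ (ℤ.pos-* x d) (ℤ.pos-* y e)))

    n/c² = mkℚᵘ (+ n) (pred (suc c ^ 2))
    k/1  = mkℚᵘ (+ k) 0
    1/2c = mkℚᵘ (+ 1) (pred (2 * suc c))

    lhs-cast : (+ n ℤ.* + 2 ℤ.+ + 1 ℤ.* + (suc c ^ 2)) ℤ.* + (1 * (2 * suc c))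
             ≡ + ((2 * n + suc c * suc c) * (2 * suc c))
    lhs-cast = trans (cong (ℤ._* + (1 * (2 * suc c))) (cast n 1 2 (suc c ^ 2)))
      (trans (sym (ℤ.pos-* (n * 2 + 1 * (suc c ^ 2)) (1 * (2 * suc c)))) (cong ℤ.+_ lhs-identity))

    rhs-cast : (+ k ℤ.* + (2 * suc c) ℤ.+ + 1 ℤ.* + 1) ℤ.* + (suc c ^ 2 * 2)
             ≡ + ((2 * k * (suc c * suc c) + suc c) * (2 * suc c))
    rhs-cast = trans (cong (ℤ._* + (suc c ^ 2 * 2)) (cast k 1 (2 * suc c) 1))
      (trans (sym (ℤ.pos-* (k * (2 * suc c) + 1 * 1) (suc c ^ 2 * 2))) (cong ℤ.+_ rhs-identity))

    fractions-≤ : 2 * n + suc c * suc c ≤ 2 * k * (suc c * suc c) + suc c →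
      n/c² +ᵘ ½ᵘ ≤ᵘ k/1 +ᵘ 1/2c
    fractions-≤ h = *≤* (begin
      (+ n ℤ.* + 2 ℤ.+ + 1 ℤ.* + (suc c ^ 2)) ℤ.* + (1 * (2 * suc c))
        ≡⟨ lhs-cast ⟩
      + ((2 * n + suc c * suc c) * (2 * suc c))
        ≤⟨ ℤ.+≤+ (*-monoˡ-≤ (2 * suc c) h) ⟩
      + ((2 * k * (suc c * suc c) + suc c) * (2 * suc c))
        ≡⟨ rhs-cast ⟨
      (+ k ℤ.* + (2 * suc c) ℤ.+ + 1 ℤ.* + 1) ℤ.* + (suc c ^ 2 * 2) ∎)
      where open ℤ.≤-Reasoning

    fractions-≃ : 2 * n + suc c * suc c ≡ 2 * k * (suc c * suc c) + suc c → n/c² +ᵘ ½ᵘ ≃ᵘ k/1 +ᵘ 1/2c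
    fractions-≃ h = *≡* (trans lhs-cast (trans (cong (λ x → + (x * (2 * suc c))) h) (sym rhs-cast)))

  -- The term 1/(2c) is first added to the right-hand side, so that the comparison involves only
  -- sums, and is then subtracted from both sides.
  suc-bound-≤ : 2 * n + suc c * suc c ≤ 2 * k * (suc c * suc c) + suc c →
    (+ n / suc c ^ 2) +ℚ ½ -ℚ (+ 1 / (2 * suc c)) ≤ℚ + k / 1
  suc-bound-≤ h = begin
    (+ n / suc c ^ 2) +ℚ ½ -ℚ r          ≡⟨ cong (_-ℚ r) (fromℚᵘ-homo-+ n/c² ½ᵘ) ⟩
    fromℚᵘ (n/c² +ᵘ ½ᵘ) -ℚ r             ≤⟨ ℚ.+-monoˡ-≤ (-ℚ r) (fromℚᵘ-mono-≤ (fractions-≤ h)) ⟩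
    fromℚᵘ (k/1 +ᵘ 1/2c) -ℚ r            ≡⟨ cong (_-ℚ r) (fromℚᵘ-homo-+ k/1 1/2c) ⟨
    (+ k / 1) +ℚ r -ℚ r                  ≡⟨ p+q-q≡p (+ k / 1) r ⟩
    + k / 1                              ∎
    where
    open ℚ.≤-Reasoning
    r = + 1 / (2 * suc c)

  suc-bound-≡ : 2 * n + suc c * suc c ≡ 2 * k * (suc c * suc c) + suc c →
    (+ n / suc c ^ 2) +ℚ ½ -ℚ (+ 1 / (2 * suc c)) ≡ + k / 1
  suc-bound-≡ h = trans (cong (_-ℚ r) (trans (fromℚᵘ-homo-+ n/c² ½ᵘ)
      (trans (ℚ.fromℚᵘ-cong (fractions-≃ h)) (sym (fromℚᵘ-homo-+ k/1 1/2c)))))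
    (p+q-q≡p (+ k / 1) r)
    where r = + 1 / (2 * suc c)

-- Allows a denominator such as `order G ∸ δ G`, which is nonzero but not syntactically a successor.
bound-≤ : ∀ n k c .{{_ : NonZero c}} .{{_ : NonZero (c ^ 2)}} .{{_ : NonZero (2 * c)}} →
  2 * n + c * c ≤ 2 * k * (c * c) + c →
  (+ n / c ^ 2) +ℚ ½ -ℚ (+ 1 / (2 * c)) ≤ℚ + k / 1
bound-≤ n k (suc c) = suc-bound-≤ n k c

bound-≡ : ∀ n k c .{{_ : NonZero c}} .{{_ : NonZero (c ^ 2)}} .{{_ : NonZero (2 * c)}} →
  2 * n + c * c ≡ 2 * k * (c * c) + c →
  (+ n / c ^ 2) +ℚ ½ -ℚ (+ 1 / (2 * c)) ≡ + k / 1
bound-≡ n k (suc c) = suc-bound-≡ n k c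

lowerBound≤η : ∀ G → lowerBound G ≤ℚ (+ η G / 1)
lowerBound≤η G = bound-≤ (order G) (η G) (order G ∸ δ G)
  {{order∸δ≢0 G}} {{m^n≢0 _ 2 {{order∸δ≢0 G}}}} {{m*n≢0 2 _ {{_}} {{order∸δ≢0 G}}}}
  (order-bound G)

-- The extremal complete multipartite graphs.

completeMultipartite : ∀ n → NonZero n → (Fin n → ℕ) → Graph
completeMultipartite n n≢0 part = record
  { order    = n
  ; nonEmpty = n≢0
  ; _~_      = λ u v → part u ≢ part v
  ; _~?_     = λ u v → ¬? (part u ≟ part v)
  ; ~-sym    = λ u≢v → u≢v ∘ sym
  ; ~-irrefl = λ u≡v u≢v → u≢v (cong part u≡v)
  }

-- Positive labels on s vertices, each exceeding 1 by at most a, with total excess e.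
spread : ℕ → ℕ → ℕ → List ℕ
spread a zero    e = []
spread a (suc s) e = suc (a ⊓ e) ∷ spread a s (e ∸ a)

length-spread : ∀ a s e → length (spread a s e) ≡ s
length-spread a zero    e = refl
length-spread a (suc s) e = cong suc (length-spread a s (e ∸ a))

spread-bounds : ∀ a s e → All (λ l → 1 ≤ l × l ≤ suc a) (spread a s e)
spread-bounds a zero    e = []
spread-bounds a (suc s) e = (s≤s z≤n , s≤s (m⊓n≤m a e)) ∷ spread-bounds a s (e ∸ a)

-- The greedy filling leaves nothing over because `e` fits into the total capacity `s * a`.
sum-spread : ∀ a s e → e ≤ s * a → sum (spread a s e) ≡ s + e
sum-spread a zero    e e≤0 = sym (n≤0⇒n≡0 e≤0)
sum-spread a (suc s) e e≤  = cong suc (begin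
  a ⊓ e + sum (spread a s (e ∸ a))
    ≡⟨ cong (_+_ _) (sum-spread a s (e ∸ a) (m≤n+o⇒m∸n≤o e a e≤)) ⟩
  a ⊓ e + (s + (e ∸ a))   ≡⟨ swap (a ⊓ e) s (e ∸ a) ⟩
  s + (a ⊓ e + (e ∸ a))   ≡⟨ cong (_+_ s) (m⊓n+n∸m≡n a e) ⟩
  s + e                   ∎)
  where
  open ≡-Reasoning
  swap : ∀ m n o → m + (n + o) ≡ n + (m + o)
  swap = solve-∀

module Extremal (a b : ℕ) (1≤b : 1 ≤ b) where

  -- The target additive number is `suc a`, so `a` is the largest excess of a label over 1. Ones on
  -- the `r ⊓ b` vertices leave `r ∸ b` of the sum `r` to distribute.
  labels : ℕ → List ℕ
  labels r = spread a (r ⊓ b) (r ∸ b)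

  sum-labels : ∀ {r} → r ≤ suc a * b → sum (labels r) ≡ r
  sum-labels {r} r≤ = trans (sum-spread a (r ⊓ b) (r ∸ b) excess)
    (trans (cong (_+ (r ∸ b)) (⊓-comm r b)) (m⊓n+n∸m≡n b r))
    where
    excess : r ∸ b ≤ (r ⊓ b) * a
    -- Up to `b` there is no excess; beyond it the part has `b` vertices, of capacity `a * b`, and
    -- `r≤` unfolds to `r ≤ b + a * b`.
    excess with ≤-total r b
    ... | inj₁ r≤b rewrite m≤n⇒m∸n≡0 r≤b = z≤n
    ... | inj₂ b≤r rewrite m≥n⇒m⊓n≡n b≤r | *-comm b a = m≤n+o⇒m∸n≤o r b r≤

  -- A vertex is encoded as its part index paired with its label. Block 0 is empty, so starting the
  -- range at 0 adds no vertices.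
  block : ℕ → List (ℕ × ℕ)
  block r = map (r ,_) (labels r)

  blocks : ℕ → List (ℕ × ℕ)
  blocks m = concatMap block (downFrom m)

  length-block : ∀ r → length (block r) ≡ r ⊓ b
  length-block r = trans (length-map (r ,_) (labels r)) (length-spread a (r ⊓ b) (r ∸ b))

  length-blocks : ∀ m → length (blocks m) ≡ sum (map (_⊓ b) (downFrom m))
  length-blocks zero    = refl
  length-blocks (suc m) = trans (length-++ (block m)) (cong₂ _+_ (length-block m) (length-blocks m))

  parts< : ∀ m → All (λ p → proj₁ p < m) (blocks m)
  parts< zero    = []
  parts< (suc m) = All.++⁺ (All.map⁺ (All.universal (λ _ → ≤-refl) (labels m)))
                           (All.map m≤n⇒m≤1+n (parts< m))

  blocks-bounds : ∀ m → All (λ p → 1 ≤ proj₂ p × proj₂ p ≤ suc a) (blocks m)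
  blocks-bounds zero    = []
  blocks-bounds (suc m) = All.++⁺ (All.map⁺ (spread-bounds a (m ⊓ b) (m ∸ b))) (blocks-bounds m)

  -- Peel off the highest block: if its index exceeds `r` it is filtered out; if it equals `r` it
  -- survives whole, and all later blocks have smaller indices.
  filter-blocks : ∀ {r m} → r < m → filter (λ p → r ≟ proj₁ p) (blocks m) ≡ block r
  filter-blocks {r} {suc m} (s≤s r≤m)
    rewrite filter-++ (λ p → r ≟ proj₁ p) (block m) (blocks m) with m≤n⇒m<n∨m≡n r≤m
  ... | inj₁ r<m
    rewrite filter-none (λ p → r ≟ proj₁ p)
              {xs = block m} (All.map⁺ (All.universal (λ _ → <⇒≢ r<m) (labels m)))
    = filter-blocks r<m
  ... | inj₂ refl
    rewrite filter-all (λ p → r ≟ proj₁ p)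
              {xs = block r} (All.map⁺ (All.universal (λ _ → refl) (labels r)))
          | filter-none (λ p → r ≟ proj₁ p)
              {xs = blocks r} (All.map (λ p<r r≡p → <⇒≢ p<r (sym r≡p)) (parts< r))
    = ++-identityʳ (block r)

  top : ℕ
  top = suc a * b

  b≤top : b ≤ top
  b≤top = m≤m+n b (a * b)

  V : List (ℕ × ℕ)
  V = blocks (suc top)

  -- A vertex of the last part, which has `b` elements. It shows that the graph is nonempty and
  -- attains the maximal non-degree.
  V-top : Σ (Fin (length V)) λ v → proj₁ (lookup V v) ≡ top
  V-top = find (block top) (blocks top) refl (subst (1 ≤_) (sym (length-block top))
      (subst (1 ≤_) (sym (m≥n⇒m⊓n≡n b≤top)) 1≤b))
    where
    -- Abstracting `block top` to `xs` permits matching on a cons; `downFrom` puts this block at the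
    -- front of `V`.
    find : ∀ xs ys → xs ≡ block top → 1 ≤ length xs →
      Σ (Fin (length (xs ++ ys))) λ v → proj₁ (lookup (xs ++ ys) v) ≡ top
    find (x ∷ xs) ys eq _ = Fin.zero , All.head
      (subst (All (λ p → proj₁ p ≡ top)) (sym eq) (All.map⁺ (All.universal (λ _ → refl) (labels top))))

  V≢0 : NonZero (length V)
  V≢0 = nonZero (proj₁ V-top)
    where
    nonZero : ∀ {n} → Fin n → NonZero n
    nonZero {suc _} _ = _

  part label : Fin (length V) → ℕ
  part  = proj₁ ∘ lookup V
  label = proj₂ ∘ lookup V

  G : Graph
  G = completeMultipartite (length V) V≢0 part

  part≤ : ∀ v → part v ≤ top
  part≤ v = ≤-pred (All.lookup (parts< (suc top)) (∈-lookup v))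

  map-lookup-nonN : ∀ v → map (lookup V) (nonN G v) ≡ block (part v)
  map-lookup-nonN v = begin
    map (lookup V) (nonN G v)
      -- Non-adjacency is a doubly negated equality of part indices, and decidability removes the
      -- negations.
      ≡⟨ cong (map (lookup V)) (filter-≐ _ (λ w → part v ≟ part w)
           ((λ {w} → decidable-stable (part v ≟ part w)) , λ eq ≢ → ≢ eq) (allFin (length V))) ⟩
    map (lookup V) (filter (λ w → part v ≟ part w) (allFin (length V)))
      ≡⟨ filter-map (λ p → part v ≟ proj₁ p) (lookup V) (allFin (length V)) ⟩
    filter (λ p → part v ≟ proj₁ p) (map (lookup V) (allFin (length V)))
      ≡⟨ cong (filter (λ p → part v ≟ proj₁ p)) (map-lookup-allFin V) ⟩
    filter (λ p → part v ≟ proj₁ p) V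
      ≡⟨ filter-blocks (s≤s (part≤ v)) ⟩
    block (part v) ∎
    where open ≡-Reasoning

  nonDegree≡ : ∀ v → nonDegree G v ≡ part v ⊓ b
  nonDegree≡ v = trans (sym (length-map (lookup V) (nonN G v)))
    (trans (cong length (map-lookup-nonN v)) (length-block (part v)))

  -- The non-neighbourhood of `v` is its own part, whose labels were chosen to sum to the part
  -- index.
  R≡part : ∀ v → R G label v ≡ part v
  R≡part v = begin
    sum (map label (nonN G v))                      ≡⟨ cong sum (map-∘ (nonN G v)) ⟩
    sum (map proj₂ (map (lookup V) (nonN G v)))     ≡⟨ cong (sum ∘ map proj₂) (map-lookup-nonN v) ⟩
    sum (map proj₂ (block (part v)))                ≡⟨ cong sum (map-∘ (labels (part v))) ⟨
    sum (map id (labels (part v)))                  ≡⟨ cong sum (map-id (labels (part v))) ⟩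
    sum (labels (part v))                           ≡⟨ sum-labels (part≤ v) ⟩
    part v                                          ∎
    where open ≡-Reasoning

  labeling : HasAdditiveLabeling G (suc a)
  labeling = label , (λ v → All.lookup (blocks-bounds (suc top)) (∈-lookup v)) ,
    -- Equal `S` gives equal `R`, that is, equal part indices, which adjacency excludes.
    λ u v u≁v eq → u≁v (trans (sym (R≡part u)) (trans (S≡⇒R≡ G label eq) (R≡part v)))

  order∸δ≡b : order G ∸ δ G ≡ b
  order∸δ≡b = order∸δ≡ G
    (λ v → subst (_≤ b) (sym (nonDegree≡ v)) (m⊓n≤n (part v) b))
    (proj₁ V-top)
    (trans (nonDegree≡ (proj₁ V-top))
      (trans (cong (_⊓ b) (proj₂ V-top)) (m≥n⇒m⊓n≡n b≤top)))

  order≡ : 2 * order G + b * b ≡ 2 * suc a * (b * b) + b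
  order≡ = trans (cong (λ n → 2 * n + b * b) (length-blocks (suc top))) (sum-⊓ b (suc a))

  -- `labeling` gives the upper bound. For the lower one, `order≡` and `order-bound` compare the
  -- same left-hand side with expressions in `suc a` and `η G`; cancelling `b`, `b * b` and 2 leaves
  -- `suc a ≤ η G`.
  η≡ : η G ≡ suc a
  η≡ = ≤-antisym (proj₂ (proj₂ (η-isAdditiveNumber G)) (suc a) (s≤s z≤n) labeling)
    (*-cancelˡ-≤ 2 (*-cancelʳ-≤ (2 * suc a) (2 * η G) (b * b)
      {{m*n≢0 b b {{>-nonZero 1≤b}} {{>-nonZero 1≤b}}}}
      (+-cancelʳ-≤ b _ _ (subst (_≤ 2 * η G * (b * b) + b) order≡
        (subst (λ c → 2 * order G + c * c ≤ 2 * η G * (c * c) + c) order∸δ≡b (order-bound G))))))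

  η≡lowerBound : + η G / 1 ≡ lowerBound G
  η≡lowerBound = sym (bound-≡ (order G) (η G) (order G ∸ δ G)
    {{order∸δ≢0 G}} {{m^n≢0 _ 2 {{order∸δ≢0 G}}}} {{m*n≢0 2 _ {{_}} {{order∸δ≢0 G}}}}
    (subst (λ c → 2 * order G + c * c ≡ 2 * η G * (c * c) + c) (sym order∸δ≡b)
      (trans order≡ (cong (λ k → 2 * k * (b * b) + b) (sym η≡)))))

theorem2 : (∀ (G : Graph) → lowerBound G ≤ℚ (+ η G / 1))
    × (∀ (a b : ℕ) → 1 ≤ a → 1 ≤ b →
    Σ Graph λ G → η G ≡ a × order G ∸ δ G ≡ b × (+ η G / 1) ≡ lowerBound G)
theorem2 = lowerBound≤η , sharp
  where
  sharp : ∀ a b → 1 ≤ a → 1 ≤ b →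
    Σ Graph λ G → η G ≡ a × order G ∸ δ G ≡ b × (+ η G / 1) ≡ lowerBound G
  sharp (suc a) b _ 1≤b = G , η≡ , order∸δ≡b , η≡lowerBound
    where open Extremal a b 1≤b
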